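{- Let $m\ge 4$ be an integer. For every $f:\{0,1\}^N\to\{0,1\}$, $$C^{*,\oplus}(f\circ\mathrm{IND}_m^N)\ge \tfrac12\, C^{dt}(f)\log_2 m.$$ Furthermore, for every relation $R\subseteq\{0,1\}^N\times W$, $$C^{*,\oplus}(R\circ\mathrm{IND}_m^N)\ge\tfrac12\,C^{dt}(R)\log_2 m.$$
   Context: $\mathrm{IND}_m:[m]\times\{0,1\}^m\to\{0,1\}$, $\mathrm{IND}_m(x,y)=y_x$; $\mathrm{IND}_m^N(x,y)=(\mathrm{IND}_m(x_i,y_i))_{i\in[N]}$ for $x\in[m]^N$ (Alice's input) and $y\in(\{0,1\}^m)^N$ (Bob's input, viewed as a vector in $\mathbb{F}_2^{[N]\times[m]}$). The lifted function is $(f\circ\mathrm{IND}_m^N)(x,y)=f(\mathrm{IND}_m^N(x,y))$; the lifted relation $R\circ\mathrm{IND}_m^N$ relates $(x,y)$ to $w$ iff $(\mathrm{IND}_m^N(x,y),w)\in R$. A $(*,\oplus)$-protocol (semi-structured protocol) is a deterministic two-party communication protocol in which Alice may send arbitrary functions of her input (and the transcript so far) but each bit Bob sends is a parity $\bigoplus_{(i,j)\in S}y_{i,j}$ of his input bits, with $S$ depending on the transcript so far. $C^{*,\oplus}(F)$ is the minimum worst-case number of bits communicated by a $(*,\oplus)$-protocol computing $F$; for a relation, the protocol on input $(x,y)$ must output some $w$ related to $(x,y)$ (or $\bot$ if none exists). $C^{dt}(f)$ (resp. $C^{dt}(R)$) is the minimum height of a decision tree querying bits of $z\in\{0,1\}^N$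 that computes $f$ (resp. outputs some $w$ with $(z,w)\in R$, or $\bot$ if no such $w$ exists). -}

module Defs where

open import Level using (Level; _⊔_)
open import Data.Bool using (Bool; true; false; _∧_; _xor_)
open import Data.Fin using (Fin)
open import Data.Maybe using (Maybe; just; nothing)
open import Data.Nat as ℕ using (ℕ; suc; _≤_)
open import Data.Product using (_×_; Σ-syntax)
open import Data.Vec using (Vec; lookup; zipWith; concat; foldr′)
open import Relation.Binary.Core using (REL)
open import Relation.Binary.PropositionalEquality using (_≡_)
open import Relation.Nullary using (¬_)
open import Relation.Unary using (Pred)

private
  variable
    o a ℓ : Level

IsMinimum : Pred ℕ ℓ → Pred ℕ ℓ
IsMinimum P n = P n × (∀ k → P k → n ≤ k)

-- Correct outputs for a search problem with solution set Q.  The output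
-- nothing stands for ⊥ and is correct only when there is no solution.
data IsAnswer {W : Set a} (Q : Pred W ℓ) : Pred (Maybe W) (a ⊔ ℓ) where
  solution    : ∀ {w} → Q w → IsAnswer Q (just w)
  no-solution : (∀ w → ¬ Q w) → IsAnswer Q nothing

data DecisionTree (N : ℕ) (O : Set o) : Set o where
  output : O → DecisionTree N O
  query  : Fin N → (Bool → DecisionTree N O) → DecisionTree N O

module _ {N : ℕ} {O : Set o} where

  evalDT : DecisionTree N O → Vec Bool N → O
  evalDT (output w)     z = w
  evalDT (query i next) z = evalDT (next (lookup z i)) z

  height : DecisionTree N O → ℕ
  height (output w)     = 0
  height (query i next) = suc (height (next false) ℕ.⊔ height (next true))

-- IsCdt f d says that C^dt(f) = d, and IsCdtRel R d that C^dt(R) = d.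

IsCdt : {N : ℕ} → (Vec Bool N → Bool) → ℕ → Set
IsCdt {N} f = IsMinimum λ d → Σ[ T ∈ DecisionTree N Bool ]
  (∀ z → evalDT T z ≡ f z) × height T ≡ d

IsCdtRel : {N : ℕ} {W : Set a} → REL (Vec Bool N) W ℓ → ℕ → Set (a ⊔ ℓ)
IsCdtRel {N = N} {W} R = IsMinimum λ d → Σ[ T ∈ DecisionTree N (Maybe W) ]
  (∀ z → IsAnswer (R z) (evalDT T z)) × height T ≡ d

AliceInput : ℕ → ℕ → Set
AliceInput m N = Vec (Fin m) N

BobInput : ℕ → ℕ → Set
BobInput m N = Vec (Vec Bool m) N

-- The parity of the entries y_{i,j} with (i , j) ∈ S, where S ⊆ [N] × [m] is
-- given by its indicator matrix.
parity : ∀ {m N} → Vec (Vec Bool m) N → BobInput m N → Bool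
parity S y = foldr′ _xor_ false (concat (zipWith (zipWith _∧_) S y))

-- (*,⊕)-protocols.  A node of the tree is a transcript so far, so the speaker,
-- Alice's function and Bob's set S all depend on the transcript.
data Protocol (m N : ℕ) (O : Set o) : Set o where
  output : O → Protocol m N O
  alice  : (AliceInput m N → Bool) → (Bool → Protocol m N O) → Protocol m N O
  bob    : Vec (Vec Bool m) N → (Bool → Protocol m N O) → Protocol m N O

module _ {m N : ℕ} {O : Set o} where

  run : Protocol m N O → AliceInput m N → BobInput m N → O
  run (output w)     x y = w
  run (alice g next) x y = run (next (g x)) x y
  run (bob S next)   x y = run (next (parity S y)) x y

  bitsSent : Protocol m N O → AliceInput m N → BobInput m N → ℕ
  bitsSent (output w)     x y = 0
  bitsSent (alice g next) x y = suc (bitsSent (next (g x)) x y)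
  bitsSent (bob S next)   x y = suc (bitsSent (next (parity S y)) x y)

-- IsC*⊕ F c says that C^{*,⊕}(F) = c, and IsC*⊕Rel R c that C^{*,⊕}(R) = c.

IsC*⊕ : {m N : ℕ} → (AliceInput m N → BobInput m N → Bool) → ℕ → Set
IsC*⊕ {m} {N} F = IsMinimum λ c → Σ[ Π ∈ Protocol m N Bool ]
  (∀ x y → run Π x y ≡ F x y) × (∀ x y → bitsSent Π x y ≤ c)

IsC*⊕Rel : {m N : ℕ} {W : Set a} →
           (AliceInput m N → BobInput m N → Pred W ℓ) → ℕ → Set (a ⊔ ℓ)
IsC*⊕Rel {m = m} {N} {W} R = IsMinimum λ c → Σ[ Π ∈ Protocol m N (Maybe W) ]
  (∀ x y → IsAnswer (R x y) (run Π x y)) × (∀ x y → bitsSent Π x y ≤ c)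

IND : ∀ {m} → Fin m → Vec Bool m → Bool
IND x y = lookup y x

INDᴺ : ∀ {m N} → AliceInput m N → BobInput m N → Vec Bool N
INDᴺ = zipWith IND

-- Composition with INDᴺ; A is Bool for a function and Pred W ℓ for a relation.
_∘INDᴺ : ∀ {m N} {A : Set a} →
         (Vec Bool N → A) → AliceInput m N → BobInput m N → A
(f ∘INDᴺ) x y = f (INDᴺ x y)

{-# OPTIONS --safe #-}
-- A decision tree simulates the protocol while keeping a set X of inputs for
-- Alice and an affine family of inputs for Bob that agree with the transcript.
-- When Alice speaks, the larger half of X is kept.  When Bob speaks, his parity
-- is an affine form on the family; unless it is constant, take an entry (i , j)
-- occurring in it.  If x_i = j for at most half of X (or i was queried), drop
-- those x and solve the form for y_{i,j}, which makes it constant and does not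
-- constrain the bits y_{i,x_i} that Alice reads.  Otherwise query z_i, keep the
-- x with x_i = j, set y_{i,j} = z_i, and treat the rest of the form in the same
-- way.  Every transmitted bit and every query at most halves X, while X stays
-- in a subcube which a query makes m times smaller.  Hence q queries on c bits
-- give (m/2)^q ≤ 2^c, and m/2 ≥ √m as m ≥ 4.
module Submission where

open import Level using (Level)
import Algebra.Properties.CommutativeMonoid.Sum
open import Data.Bool using (Bool; true; false; _∧_; _xor_)
open import Data.Bool.Properties using (_≟_; xor-assoc; xor-comm; xor-same; xor-identityʳ; ∧-distribʳ-xor; ¬-not)
open import Data.Empty using (⊥-elim)
open import Data.Fin using (Fin; zero; suc)
open import Data.Fin.Properties using (any?)
import Data.Fin.Properties as Fin
open import Data.Maybe using (Maybe; just; nothing)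
open import Data.Nat using (ℕ; zero; suc; _≤_; _<_; _+_; _*_; _^_; _⊔_; z≤n; s≤s⁻¹; z<s; NonZero; >-nonZero)
open import Data.Nat.Properties hiding (_≟_)
open import Data.Nat.Solver using (module +-*-Solver)
open import Data.Product using (_×_; _,_; proj₁; proj₂; ∃; ∃₂)
open import Data.Sum using (inj₁; inj₂)
open import Data.Vec using (Vec; []; _∷_; _++_; lookup; map; replicate; zipWith; foldr′; _[_]≔_; _[_]%=_)
open import Data.Vec.Properties using (lookup-zipWith; lookup-map; lookup-replicate; lookup∘update; lookup∘update′; lookup∘updateAt; lookup∘updateAt′)
open import Data.Vec.Relation.Binary.Pointwise.Extensional using (ext; Pointwise-≡⇒≡)
open import Function using (_∘_; id; const)
open import Relation.Binary.Core using (REL)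
open import Relation.Binary.PropositionalEquality using (_≡_; _≢_; refl; sym; trans; cong; cong₂; subst; module ≡-Reasoning)
open import Relation.Nullary using (yes; no; does; contradiction)
open import Relation.Nullary.Decidable using (dec-true)
open import Defs

private
  variable
    m n N : ℕ

  module Sum = Algebra.Properties.CommutativeMonoid.Sum +-0-commutativeMonoid

open Sum using (sum)

-- Parities and affine forms

Matrix : ℕ → ℕ → Set
Matrix m N = Vec (Vec Bool m) N

entry : Matrix m N → Fin N → Fin m → Bool
entry A i j = lookup (lookup A i) j

set : Fin N → Fin m → Bool → Matrix m N → Matrix m N
set i j b A = A [ i ]%= (_[ j ]≔ b)

entry-set : ∀ i j b (A : Matrix m N) → entry (set i j b A) i j ≡ b
entry-set i j b A = trans (cong (λ r → lookup r j) (lookup∘updateAt i A))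
                          (lookup∘update j (lookup A i) b)

-- The hypothesis is `(k , l) ≢ (i , j)` in curried form. In `specialise` only the case `k ≡ i`
-- needs an argument.
entry-set′ : ∀ i j b (A : Matrix m N) k l → (k ≡ i → l ≢ j) →
             entry (set i j b A) k l ≡ entry A k l
entry-set′ i j b A k l l≢j with k Fin.≟ i
... | yes refl = trans (cong (λ r → lookup r l) (lookup∘updateAt i A))
                       (lookup∘update′ (l≢j refl) (lookup A i) b)
... | no k≢i   = cong (λ r → lookup r l) (lookup∘updateAt′ k i k≢i A)

xor-interchange : ∀ a b c d → (a xor b) xor (c xor d) ≡ (a xor c) xor (b xor d)
xor-interchange a b c d = begin
  (a xor b) xor (c xor d)  ≡⟨ xor-assoc a b (c xor d) ⟩
  a xor (b xor (c xor d))  ≡⟨ cong (a xor_) (sym (xor-assoc b c d)) ⟩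
  a xor ((b xor c) xor d)  ≡⟨ cong (λ e → a xor (e xor d)) (xor-comm b c) ⟩
  a xor ((c xor b) xor d)  ≡⟨ cong (a xor_) (xor-assoc c b d) ⟩
  a xor (c xor (b xor d))  ≡⟨ sym (xor-assoc a c (b xor d)) ⟩
  (a xor c) xor (b xor d)  ∎
  where open ≡-Reasoning

⨁ : Vec Bool n → Bool
⨁ = foldr′ _xor_ false

⨁-++ : (xs : Vec Bool m) (ys : Vec Bool n) → ⨁ (xs ++ ys) ≡ ⨁ xs xor ⨁ ys
⨁-++ []       ys = refl
⨁-++ (x ∷ xs) ys = trans (cong (x xor_) (⨁-++ xs ys)) (sym (xor-assoc x _ _))

_∙_ : Vec Bool n → Vec Bool n → Bool
s ∙ y = ⨁ (zipWith _∧_ s y)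

∙-distribʳ-xor : (s t y : Vec Bool n) → zipWith _xor_ s t ∙ y ≡ (s ∙ y) xor (t ∙ y)
∙-distribʳ-xor []      []      []      = refl
∙-distribʳ-xor (a ∷ s) (b ∷ t) (c ∷ y) =
  trans (cong₂ _xor_ (∧-distribʳ-xor c a b) (∙-distribʳ-xor s t y))
        (xor-interchange (a ∧ c) (b ∧ c) _ _)

-- Clearing the coefficient at `j` hides the old entry of `y`, so the remaining product can use `y`
-- unchanged.
∙-update : ∀ (s y : Vec Bool n) j v →
           s ∙ (y [ j ]≔ v) ≡ (lookup s j ∧ v) xor ((s [ j ]≔ false) ∙ y)
∙-update (a ∷ s) (b ∷ y) zero    v = refl
∙-update (a ∷ s) (b ∷ y) (suc j) v = begin
  (a ∧ b) xor (s ∙ (y [ j ]≔ v))                             ≡⟨ cong ((a ∧ b) xor_) (∙-update s y j v) ⟩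
  -- With `false` as its first summand, the interchange law becomes left commutativity.
  (a ∧ b) xor ((lookup s j ∧ v) xor ((s [ j ]≔ false) ∙ y))  ≡⟨ xor-interchange false (a ∧ b) (lookup s j ∧ v) _ ⟩
  (lookup s j ∧ v) xor ((a ∧ b) xor ((s [ j ]≔ false) ∙ y))  ∎
  where open ≡-Reasoning

∙-zero : (s y : Vec Bool n) → (∀ j → lookup s j ≡ false) → s ∙ y ≡ false
∙-zero []      []      s≡0 = refl
∙-zero (a ∷ s) (b ∷ y) s≡0 = cong₂ _xor_ (cong (_∧ b) (s≡0 zero)) (∙-zero s y (s≡0 ∘ suc))

parity-∷ : ∀ s (S : Matrix m N) y Y → parity (s ∷ S) (y ∷ Y) ≡ (s ∙ y) xor parity S Y
parity-∷ s S y Y = ⨁-++ (zipWith _∧_ s y) _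

parity-distribʳ-xor : (S T Y : Matrix m N) →
  parity (zipWith (zipWith _xor_) S T) Y ≡ parity S Y xor parity T Y
parity-distribʳ-xor []      []      []      = refl
parity-distribʳ-xor (s ∷ S) (t ∷ T) (y ∷ Y) = begin
  parity (s⊕t ∷ S⊕T) (y ∷ Y)                             ≡⟨ parity-∷ s⊕t S⊕T y Y ⟩
  (s⊕t ∙ y) xor parity S⊕T Y                             ≡⟨ cong₂ _xor_ (∙-distribʳ-xor s t y) (parity-distribʳ-xor S T Y) ⟩
  ((s ∙ y) xor (t ∙ y)) xor (parity S Y xor parity T Y)  ≡⟨ xor-interchange (s ∙ y) _ _ _ ⟩
  ((s ∙ y) xor parity S Y) xor ((t ∙ y) xor parity T Y)  ≡⟨ sym (cong₂ _xor_ (parity-∷ s S y Y) (parity-∷ t T y Y)) ⟩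
  parity (s ∷ S) (y ∷ Y) xor parity (t ∷ T) (y ∷ Y)      ∎
  where
  open ≡-Reasoning
  s⊕t = zipWith _xor_ s t
  S⊕T = zipWith (zipWith _xor_) S T

parity-set : ∀ (S Y : Matrix m N) i j v →
  parity S (set i j v Y) ≡ (entry S i j ∧ v) xor parity (set i j false S) Y
parity-set (s ∷ S) (y ∷ Y) zero j v = begin
  parity (s ∷ S) ((y [ j ]≔ v) ∷ Y)                                    ≡⟨ parity-∷ s S _ Y ⟩
  (s ∙ (y [ j ]≔ v)) xor parity S Y                                    ≡⟨ cong (_xor parity S Y) (∙-update s y j v) ⟩
  ((lookup s j ∧ v) xor ((s [ j ]≔ false) ∙ y)) xor parity S Y         ≡⟨ xor-assoc (lookup s j ∧ v) _ _ ⟩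
  (lookup s j ∧ v) xor (((s [ j ]≔ false) ∙ y) xor parity S Y)         ≡⟨ cong ((lookup s j ∧ v) xor_) (sym (parity-∷ (s [ j ]≔ false) S y Y)) ⟩
  (lookup s j ∧ v) xor parity ((s [ j ]≔ false) ∷ S) (y ∷ Y)           ∎
  where open ≡-Reasoning
parity-set (s ∷ S) (y ∷ Y) (suc i) j v = begin
  parity (s ∷ S) (y ∷ set i j v Y)                                     ≡⟨ parity-∷ s S y _ ⟩
  (s ∙ y) xor parity S (set i j v Y)                                   ≡⟨ cong ((s ∙ y) xor_) (parity-set S Y i j v) ⟩
  (s ∙ y) xor ((entry S i j ∧ v) xor parity (set i j false S) Y)       ≡⟨ xor-interchange false (s ∙ y) (entry S i j ∧ v) _ ⟩
  (entry S i j ∧ v) xor ((s ∙ y) xor parity (set i j false S) Y)       ≡⟨ cong ((entry S i j ∧ v) xor_) (sym (parity-∷ s (set i j false S) y Y)) ⟩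
  (entry S i j ∧ v) xor parity (s ∷ set i j false S) (y ∷ Y)           ∎
  where open ≡-Reasoning

parity-zero : (S Y : Matrix m N) → (∀ i j → entry S i j ≡ false) → parity S Y ≡ false
parity-zero []      []      S≡0 = refl
parity-zero (s ∷ S) (y ∷ Y) S≡0 =
  trans (parity-∷ s S y Y) (cong₂ _xor_ (∙-zero s y (S≡0 zero)) (parity-zero S Y (S≡0 ∘ suc)))

-- Affine forms and substitution

Form : ℕ → ℕ → Set
Form m N = Bool × Matrix m N

⟦_⟧ : Form m N → Matrix m N → Bool
⟦ c , A ⟧ u = c xor parity A u

constant : Bool → Form m N
constant b = b , replicate _ (replicate _ false)

⟦constant⟧ : ∀ b (u : Matrix m N) → ⟦ constant b ⟧ u ≡ b
⟦constant⟧ b u = trans (cong (b xor_) (parity-zero (replicate _ (replicate _ false)) u zeros)) (xor-identityʳ b)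
  where
  zeros : ∀ i j → entry (replicate _ (replicate _ false)) i j ≡ false
  zeros i j = trans (cong (λ r → lookup r j) (lookup-replicate i _)) (lookup-replicate j false)

-- Affinity is phrased dually: parities pull back along `E` to affine forms. These pulled-back forms
-- are what Bob's messages become on the family.
Affine : (Matrix m N → Matrix m N) → Set
Affine {m} {N} E = ∀ S → ∃ λ (φ : Form m N) → ∀ u → parity S (E u) ≡ ⟦ φ ⟧ u

-- The parameters always range over all matrices. In both uses `φ` has coefficient `false` at
-- `(i , j)`, so the overwritten entry of `u` becomes a dummy parameter.
substitute : Fin N → Fin m → Form m N → Matrix m N → Matrix m N
substitute i j φ u = set i j (⟦ φ ⟧ u) u

affine-id : Affine {m} {N} id
affine-id S = (false , S) , λ u → refl

-- Pull `S` back through `E` to a form with matrix `A`. Then clear the entry of `A` at `(i , j)`,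
-- and add `φ` to the form if that entry was `true`.
affine-∘-substitute : ∀ {E : Matrix m N → Matrix m N} i j φ →
                      Affine E → Affine (E ∘ substitute i j φ)
affine-∘-substitute {E = E} i j φ@(d , B) affine S with affine S
... | (c , A) , parity≡ with entry A i j in Aᵢⱼ
...   | false = (c , set i j false A) , λ u → trans (parity≡ _) (cong (c xor_) (begin
  parity A (substitute i j φ u)                           ≡⟨ parity-set A u i j _ ⟩
  (entry A i j ∧ ⟦ φ ⟧ u) xor parity (set i j false A) u  ≡⟨ cong (λ a → (a ∧ ⟦ φ ⟧ u) xor parity (set i j false A) u) Aᵢⱼ ⟩
  parity (set i j false A) u                              ∎))
  where open ≡-Reasoning
...   | true  = (c xor d , zipWith (zipWith _xor_) B (set i j false A)) , λ u → begin
  parity S (E (substitute i j φ u))                               ≡⟨ parity≡ _ ⟩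
  c xor parity A (substitute i j φ u)                             ≡⟨ cong (c xor_) (parity-set A u i j _) ⟩
  c xor ((entry A i j ∧ ⟦ φ ⟧ u) xor parity (set i j false A) u)  ≡⟨ cong (λ a → c xor ((a ∧ ⟦ φ ⟧ u) xor parity (set i j false A) u)) Aᵢⱼ ⟩
  c xor ((d xor parity B u) xor parity (set i j false A) u)       ≡⟨ cong (c xor_) (xor-assoc d _ _) ⟩
  c xor (d xor (parity B u xor parity (set i j false A) u))       ≡⟨ sym (xor-assoc c d _) ⟩
  (c xor d) xor (parity B u xor parity (set i j false A) u)       ≡⟨ cong ((c xor d) xor_) (sym (parity-distribʳ-xor B _ u)) ⟩
  (c xor d) xor parity (zipWith (zipWith _xor_) B (set i j false A)) u  ∎
  where open ≡-Reasoning

-- A variable with coefficient 1 is solved for by the rest of the form; over the two-element field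
-- no sign appears, and everything cancels in pairs.
solution-vanishes : ∀ c (A : Matrix m N) i j → entry A i j ≡ true →
  ∀ u → ⟦ c , A ⟧ (substitute i j (c , set i j false A) u) ≡ false
solution-vanishes c A i j Aᵢⱼ u = begin
  c xor parity A (substitute i j φ u)                         ≡⟨ cong (c xor_) (parity-set A u i j _) ⟩
  c xor ((entry A i j ∧ (c xor p)) xor p)                     ≡⟨ cong (λ a → c xor ((a ∧ (c xor p)) xor p)) Aᵢⱼ ⟩
  c xor ((c xor p) xor p)                                     ≡⟨ cong (c xor_) (xor-assoc c p p) ⟩
  c xor (c xor (p xor p))                                     ≡⟨ sym (xor-assoc c c _) ⟩
  (c xor c) xor (p xor p)                                     ≡⟨ cong₂ _xor_ (xor-same c) (xor-same p) ⟩
  false                                                       ∎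
  where
  open ≡-Reasoning
  φ = c , set i j false A
  p = parity (set i j false A) u

-- Counting in subcubes

sum-mono-≤ : {f g : Fin n → ℕ} → (∀ i → f i ≤ g i) → sum f ≤ sum g
sum-mono-≤ {zero}  f≤g = z≤n
sum-mono-≤ {suc n} f≤g = +-mono-≤ (f≤g zero) (sum-mono-≤ (f≤g ∘ suc))

sum-const : ∀ n {x} → sum {n} (const x) ≡ n * x
sum-const zero        = refl
sum-const (suc n) {x} = cong (x +_) (sum-const n)

sum-positive : {f : Fin n → ℕ} → 0 < sum f → ∃ λ i → 0 < f i
sum-positive {suc n} {f} 0<sum with f zero in f₀
... | suc _ = zero , subst (0 <_) (sym f₀) z<s
... | zero  with sum-positive {n} 0<sum
...   | i , 0<fᵢ = suc i , 0<fᵢ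

sum-zero : {f : Fin n → ℕ} → (∀ i → f i ≡ 0) → sum f ≡ 0
sum-zero {n} f≡0 = trans (Sum.sum-cong-≗ f≡0) (trans (sum-const n) (*-zeroʳ n))

sum-single : ∀ {f : Fin n → ℕ} j → (∀ i → i ≢ j → f i ≡ 0) → sum f ≡ f j
sum-single {f = f} zero    f≡0 =
  trans (cong (f zero +_) (sum-zero (λ i → f≡0 (suc i) (λ ())))) (+-identityʳ _)
sum-single {f = f} (suc j) f≡0 =
  cong₂ _+_ (f≡0 zero (λ ())) (sum-single j (λ i i≢j → f≡0 (suc i) (i≢j ∘ Fin.suc-injective)))

Cube : ℕ → ℕ → Set
Cube m N = Vec (Maybe (Fin m)) N

dim : Cube m N → ℕ
dim []            = 0
dim (nothing ∷ ρ) = suc (dim ρ)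
dim (just _  ∷ ρ) = dim ρ

indicator : Bool → ℕ
indicator false = 0
indicator true  = 1

-- Recursion along the coordinates counts the points of the subcube that satisfy `p`; points outside
-- the subcube do not contribute.
count : Cube m N → (AliceInput m N → Bool) → ℕ
count []            p = indicator (p [])
count (nothing ∷ ρ) p = sum λ j → count ρ (p ∘ (j ∷_))
count (just j  ∷ ρ) p = count ρ (p ∘ (j ∷_))

count-≤ : (ρ : Cube m N) (p : AliceInput m N → Bool) → count ρ p ≤ m ^ dim ρ
count-≤ [] p with p []
... | false = z≤n
... | true  = ≤-refl
count-≤ {m} (nothing ∷ ρ) p =
  ≤-trans (sum-mono-≤ (λ j → count-≤ ρ (p ∘ (j ∷_)))) (≤-reflexive (sum-const m))
count-≤ (just j ∷ ρ) p = count-≤ ρ (p ∘ (j ∷_))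

count-full : (ρ : Cube m N) → count ρ (const true) ≡ m ^ dim ρ
count-full []                = refl
count-full {m} (nothing ∷ ρ) = trans (Sum.sum-cong-≗ {m} (λ _ → count-full ρ)) (sum-const m)
count-full (just j ∷ ρ)      = count-full ρ

count-positive : ∀ (ρ : Cube m N) p → 0 < count ρ p → ∃ λ x → p x ≡ true
count-positive [] p 0<c with p [] in p[]
... | true = [] , p[]
count-positive (nothing ∷ ρ) p 0<c with sum-positive 0<c
... | j , 0<cⱼ with count-positive ρ (p ∘ (j ∷_)) 0<cⱼ
...   | x , px = j ∷ x , px
count-positive (just j ∷ ρ) p 0<c with count-positive ρ (p ∘ (j ∷_)) 0<c
... | x , px = j ∷ x , px

-- Splitting sets and fixing coordinates

infix 5 _∣_↦_

_∣_↦_ : {A : Set} → (A → Bool) → (A → Bool) → Bool → A → Bool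
(p ∣ g ↦ b) x = p x ∧ does (g x ≟ b)

∣↦-sound : ∀ {A : Set} (p g : A → Bool) b x → (p ∣ g ↦ b) x ≡ true → p x ≡ true × g x ≡ b
∣↦-sound p g b x q with p x | g x ≟ b
... | true | yes gx≡b = refl , gx≡b

hits : Fin N → Fin m → AliceInput m N → Bool
hits i j x = does (lookup x i Fin.≟ j)

hits-sound : ∀ (i : Fin N) (j : Fin m) x → hits i j x ≡ true → lookup x i ≡ j
hits-sound i j x hit with lookup x i Fin.≟ j
... | yes xᵢ≡j = xᵢ≡j

count-split : ∀ (ρ : Cube m N) p g → count ρ p ≡ count ρ (p ∣ g ↦ true) + count ρ (p ∣ g ↦ false)
count-split [] p g with p [] | g []
... | false | _     = refl
... | true  | false = refl
... | true  | true  = refl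
count-split {m} (nothing ∷ ρ) p g =
  trans (Sum.sum-cong-≗ {m} (λ j → count-split ρ (p ∘ (j ∷_)) (g ∘ (j ∷_)))) (Sum.∑-distrib-+ {m} _ _)
count-split (just j ∷ ρ) p g = count-split ρ (p ∘ (j ∷_)) (g ∘ (j ∷_))

halve : ∀ (ρ : Cube m N) p g → ∃ λ b → count ρ p ≤ 2 * count ρ (p ∣ g ↦ b)
halve ρ p g with ≤-total (count ρ (p ∣ g ↦ true)) (count ρ (p ∣ g ↦ false))
... | inj₁ t≤f = false , (begin
  count ρ p                                              ≡⟨ count-split ρ p g ⟩
  -- `2 * n` unfolds to `n + (n + 0)`, hence the `0` in the second summand.
  count ρ (p ∣ g ↦ true) + count ρ (p ∣ g ↦ false)       ≤⟨ +-mono-≤ t≤f (m≤m+n _ 0) ⟩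
  2 * count ρ (p ∣ g ↦ false)                            ∎)
  where open ≤-Reasoning
... | inj₂ f≤t = true , (begin
  count ρ p                                              ≡⟨ count-split ρ p g ⟩
  count ρ (p ∣ g ↦ true) + count ρ (p ∣ g ↦ false)       ≤⟨ +-monoʳ-≤ _ (≤-trans f≤t (m≤m+n _ 0)) ⟩
  2 * count ρ (p ∣ g ↦ true)                             ∎)
  where open ≤-Reasoning

-- In the sum over coordinate `i` every term other than `j` vanishes, since a counted point there
-- would contradict the hypothesis. Thus fixing the coordinate loses no live input while `m ^ dim ρ`
-- shrinks by the factor `m`.
count-fix : ∀ (ρ : Cube m N) p i j → lookup ρ i ≡ nothing → (∀ x → p x ≡ true → lookup x i ≡ j) →
            count ρ p ≡ count (ρ [ i ]≔ just j) p
count-fix (nothing ∷ ρ) p zero j refl p⇒j = sum-single j empty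
  where
  empty : ∀ k → k ≢ j → count ρ (p ∘ (k ∷_)) ≡ 0
  empty k k≢j with count ρ (p ∘ (k ∷_)) in eq
  ... | zero  = refl
  ... | suc _ with count-positive ρ (p ∘ (k ∷_)) (subst (0 <_) (sym eq) z<s)
  ...   | x , px = ⊥-elim (k≢j (p⇒j (k ∷ x) px))
count-fix {m} (nothing ∷ ρ) p (suc i) j ρᵢ p⇒j =
  Sum.sum-cong-≗ {m} (λ k → count-fix ρ (p ∘ (k ∷_)) i j ρᵢ (λ x → p⇒j (k ∷ x)))
count-fix (just k ∷ ρ) p (suc i) j ρᵢ p⇒j =
  count-fix ρ (p ∘ (k ∷_)) i j ρᵢ (λ x → p⇒j (k ∷ x))

dim-fix : ∀ (ρ : Cube m N) i j → lookup ρ i ≡ nothing → dim ρ ≡ suc (dim (ρ [ i ]≔ just j))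
dim-fix (nothing ∷ ρ) zero    j refl = refl
dim-fix (nothing ∷ ρ) (suc i) j ρᵢ   = cong suc (dim-fix ρ i j ρᵢ)
dim-fix (just _  ∷ ρ) (suc i) j ρᵢ   = dim-fix ρ i j ρᵢ

-- The simulation

module _ {m N : ℕ} where

  -- Unqueried coordinates are those where cube is nothing.  The family of
  -- Bob's inputs is the image of extend; transparent says that the bits Alice
  -- reads at unqueried coordinates can still be chosen freely.
  record State : Set where
    field
      cube        : Cube m N
      live        : AliceInput m N → Bool
      extend      : BobInput m N → BobInput m N
      affine      : Affine extend
      transparent : ∀ x → live x ≡ true → ∀ u i → lookup cube i ≡ nothing →
                    entry (extend u) i (lookup x i) ≡ entry u i (lookup x i)

    size : ℕ
    size = count cube live

    -- This plays the role of `z` reaching the current node of the decision tree: earlier answers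
    -- are not stored, but are built into `extend`.
    Consistent : Vec Bool N → Set
    Consistent z = ∀ x → live x ≡ true → ∀ u i → lookup cube i ≢ nothing →
                   entry (extend u) i (lookup x i) ≡ lookup z i

  open State

  -- (m/2)^h * s ≤ m^k * 2^c, without the division.
  Bound : ℕ → ℕ → ℕ → ℕ → Set
  Bound h s k c = m ^ h * s ≤ m ^ k * 2 ^ (c + h)

  bound-bit : ∀ h {s s′} k c → s ≤ 2 * s′ → Bound h s′ k c → Bound h s k (suc c)
  bound-bit h {s} {s′} k c s≤2s′ bound = begin
    m ^ h * s                    ≤⟨ *-monoʳ-≤ (m ^ h) s≤2s′ ⟩
    m ^ h * (2 * s′)             ≡⟨ solve 2 (λ a b → a :* (con 2 :* b) := con 2 :* (a :* b)) refl (m ^ h) s′ ⟩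
    2 * (m ^ h * s′)             ≤⟨ *-monoʳ-≤ 2 bound ⟩
    2 * (m ^ k * 2 ^ (c + h))    ≡⟨ solve 2 (λ a b → con 2 :* (a :* b) := a :* (con 2 :* b)) refl (m ^ k) (2 ^ (c + h)) ⟩
    m ^ k * 2 ^ (suc c + h)      ∎
    where
    open ≤-Reasoning
    open +-*-Solver

  -- Of the two new factors on the right, `m` pays for the extra level of height and 2 for the
  -- halving of the live set.
  bound-query : ∀ h {s s′} k c → s ≤ 2 * s′ → Bound h s′ k c → Bound (suc h) s (suc k) c
  bound-query h {s} {s′} k c s≤2s′ bound = begin
    m * m ^ h * s                    ≤⟨ *-monoʳ-≤ (m * m ^ h) s≤2s′ ⟩
    m * m ^ h * (2 * s′)             ≡⟨ solve 3 (λ l a b → l :* a :* (con 2 :* b) := con 2 :* l :* (a :* b)) refl m (m ^ h) s′ ⟩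
    2 * m * (m ^ h * s′)             ≤⟨ *-monoʳ-≤ (2 * m) bound ⟩
    2 * m * (m ^ k * 2 ^ (c + h))    ≡⟨ solve 3 (λ l a b → con 2 :* l :* (a :* b) := l :* a :* (con 2 :* b)) refl m (m ^ k) (2 ^ (c + h)) ⟩
    m * m ^ k * 2 ^ suc (c + h)      ≡⟨ cong (λ e → m * m ^ k * 2 ^ e) (sym (+-suc c h)) ⟩
    m * m ^ k * 2 ^ (c + suc h)      ∎
    where
    open ≤-Reasoning
    open +-*-Solver

  restrict : ∀ σ q → (∀ x → q x ≡ true → live σ x ≡ true) → State
  restrict σ q q⊆ = record
    { cube        = cube σ
    ; live        = q
    ; extend      = extend σ
    ; affine      = affine σ
    ; transparent = λ x qx → transparent σ x (q⊆ x qx)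
    }

  -- Overwriting `(i , j)` keeps transparency as long as no remaining `x` reads that entry while `i`
  -- is free; this is `avoids`. Both solving a form and recording an answer are instances.
  specialise : ∀ σ ρ q i j (φ : Form m N) →
    (∀ x → q x ≡ true → live σ x ≡ true) →
    (∀ k → lookup ρ k ≡ nothing → lookup (cube σ) k ≡ nothing) →
    (∀ x → q x ≡ true → lookup ρ i ≡ nothing → lookup x i ≢ j) → State
  specialise σ ρ q i j φ q⊆ ρ⊆ avoids = record
    { cube        = ρ
    ; live        = q
    ; extend      = extend σ ∘ substitute i j φ
    ; affine      = affine-∘-substitute i j φ (affine σ)
    ; transparent = λ x qx u k ρₖ →
        trans (transparent σ x (q⊆ x qx) (substitute i j φ u) k (ρ⊆ k ρₖ))
              (entry-set′ i j (⟦ φ ⟧ u) u k (lookup x k) (λ { refl → avoids x qx ρₖ }))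
    }

  -- Families are given as images, so their inclusion is witnessed by a change of parameter,
  -- `refine`.
  record _⊑_ (σ′ σ : State) : Set where
    field
      live⊆   : ∀ x → live σ′ x ≡ true → live σ x ≡ true
      refine  : BobInput m N → BobInput m N
      extend≡ : ∀ u → extend σ′ u ≡ extend σ (refine u)

  open _⊑_

  positive-half : ∀ {s s′} → 0 < s → s ≤ 2 * s′ → 0 < s′
  positive-half {s′ = zero}  0<s s≤0 = contradiction 0<s (≤⇒≯ s≤0)
  positive-half {s′ = suc _} 0<s s≤  = z<s

  module _ {o : Level} {O : Set o} where

    -- One pair of inputs above each `z` suffices in `faithful`: a protocol that is correct on that
    -- pair already outputs a correct answer for `z`.
    record Simulation (Π : Protocol m N O) (σ : State) (c : ℕ) : Set o where
      field
        tree     : DecisionTree N O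
        bounded  : Bound (height tree) (size σ) (dim (cube σ)) c
        faithful : ∀ z → Consistent σ z → ∃₂ λ x u → live σ x ≡ true ×
                   INDᴺ x (extend σ u) ≡ z × evalDT tree z ≡ run Π x (extend σ u)

    open Simulation

    Cost≤ : Protocol m N O → State → ℕ → Set
    Cost≤ Π σ c = ∀ x → live σ x ≡ true → ∀ u → bitsSent Π x (extend σ u) ≤ c

    Simulable : Protocol m N O → Set o
    Simulable Π = ∀ σ c → 0 < size σ → Cost≤ Π σ c → Simulation Π σ c

    simulable-output : ∀ w → Simulable (output w)
    simulable-output w σ c 0<s cost .tree = output w
    simulable-output w σ c 0<s cost .bounded = begin
      1 * size σ                           ≡⟨ *-identityˡ _ ⟩
      size σ                               ≤⟨ count-≤ (cube σ) (live σ) ⟩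
      m ^ dim (cube σ)                     ≡⟨ sym (*-identityʳ _) ⟩
      m ^ dim (cube σ) * 1                 ≤⟨ *-monoʳ-≤ (m ^ dim (cube σ)) (m^n>0 2 (c + 0)) ⟩
      m ^ dim (cube σ) * 2 ^ (c + 0)       ∎
      where open ≤-Reasoning
    simulable-output w σ c 0<s cost .faithful z consistent with count-positive (cube σ) (live σ) 0<s
    ... | x , lx = x , u , lx , Pointwise-≡⇒≡ (ext reads) , refl
      where
      -- Row `i` is constantly `z_i`, so Alice reads `z_i` there wherever her pointer `x_i` lies.
      u = map (replicate m) z
      reads : ∀ i → lookup (INDᴺ x (extend σ u)) i ≡ lookup z i
      reads i = trans (lookup-zipWith IND i x (extend σ u)) (at (lookup (cube σ) i) refl)
        where
        at : ∀ r → lookup (cube σ) i ≡ r → entry (extend σ u) i (lookup x i) ≡ lookup z i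
        -- Queried coordinates are settled by consistency, free ones by transparency and the choice
        -- of `u`.
        at (just _) ρᵢ = consistent x lx u i (λ ρᵢ≡ → contradiction (trans (sym ρᵢ) ρᵢ≡) λ ())
        at nothing  ρᵢ = begin
          entry (extend σ u) i (lookup x i)               ≡⟨ transparent σ x lx u i ρᵢ ⟩
          entry u i (lookup x i)                          ≡⟨ cong (λ r → lookup r (lookup x i)) (lookup-map i (replicate m) z) ⟩
          lookup (replicate m (lookup z i)) (lookup x i)  ≡⟨ lookup-replicate (lookup x i) _ ⟩
          lookup z i                                      ∎
          where open ≡-Reasoning

    -- In the inputs of σ′, the first bit of Π has a known value, and Π′ is the
    -- protocol that remains after it.
    Step : Protocol m N O → Protocol m N O → State → Set o
    Step Π Π′ σ′ = ∀ x → live σ′ x ≡ true → ∀ u →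
      run Π x (extend σ′ u) ≡ run Π′ x (extend σ′ u) ×
      bitsSent Π x (extend σ′ u) ≡ suc (bitsSent Π′ x (extend σ′ u))

    cost-⊑ : ∀ Π {σ′ σ} c → σ′ ⊑ σ → Cost≤ Π σ c → Cost≤ Π σ′ c
    cost-⊑ Π c r cost x lx u =
      subst (λ y → bitsSent Π x y ≤ c) (sym (extend≡ r u)) (cost x (live⊆ r x lx) (refine r u))

    -- The bookkeeping common to both players: the known bit costs one unit of the budget and at
    -- most half of the live set, and no query is made.
    advance : ∀ {Π Π′ σ′ σ} → σ′ ⊑ σ → cube σ′ ≡ cube σ → size σ ≤ 2 * size σ′ →
              Step Π Π′ σ′ → Simulable Π′ → ∀ c → 0 < size σ → Cost≤ Π σ c → Simulation Π σ c
    -- An exhausted budget is impossible, because some live input still sends this bit.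
    advance {Π} {σ′ = σ′} r cube≡ s≤ step simulable zero 0<s cost
      with count-positive (cube σ′) (live σ′) (positive-half 0<s s≤)
    ... | x , lx = contradiction
      (subst (_≤ 0) (proj₂ (step x lx u₀)) (cost-⊑ Π 0 r cost x lx u₀)) λ ()
      where u₀ = replicate _ (replicate _ false)
    advance {Π} {Π′} {σ′} {σ} r cube≡ s≤ step simulable (suc c) 0<s cost = record
      { tree     = tree sim
      ; bounded  = bound-bit (height (tree sim)) (dim (cube σ)) c s≤
                     (subst (λ ρ → Bound (height (tree sim)) (size σ′) (dim ρ) c) cube≡ (bounded sim))
      ; faithful = faithful′
      }
      where
      sim : Simulation Π′ σ′ c
      sim = simulable σ′ c (positive-half 0<s s≤) λ x lx u →
        s≤s⁻¹ (subst (_≤ suc c) (proj₂ (step x lx u)) (cost-⊑ Π (suc c) r cost x lx u))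

      faithful′ : ∀ z → Consistent σ z → ∃₂ λ x u → live σ x ≡ true ×
                  INDᴺ x (extend σ u) ≡ z × evalDT (tree sim) z ≡ run Π x (extend σ u)
      faithful′ z consistent with faithful sim z (λ x lx u i ρᵢ →
          subst (λ y → entry y i (lookup x i) ≡ lookup z i) (sym (extend≡ r u))
            (consistent x (live⊆ r x lx) (refine r u) i
              (subst (λ ρ → lookup ρ i ≢ nothing) cube≡ ρᵢ)))
      ... | x , u , lx , ind≡z , eval≡run =
        x , refine r u , live⊆ r x lx ,
        subst (λ y → INDᴺ x y ≡ z) (extend≡ r u) ind≡z ,
        subst (λ y → evalDT (tree sim) z ≡ run Π x y) (extend≡ r u)
          (trans eval≡run (sym (proj₁ (step x lx u))))

    simulable-alice : ∀ g next → (∀ b → Simulable (next b)) → Simulable (alice g next)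
    simulable-alice g next simulable σ c with halve (cube σ) (live σ) g
    ... | b , s≤ = advance {σ′ = restrict σ (live σ ∣ g ↦ b) (λ x → proj₁ ∘ ∣↦-sound (live σ) g b x)}
      (record { live⊆ = λ x → proj₁ ∘ ∣↦-sound (live σ) g b x ; refine = id ; extend≡ = λ _ → refl })
      refl s≤ step (simulable b) c
      where
      step : ∀ x → (live σ ∣ g ↦ b) x ≡ true → ∀ u → _
      step x lx u with ∣↦-sound (live σ) g b x lx
      ... | _ , gx≡b = cong (λ b → run (next b) x (extend σ u)) gx≡b ,
                       cong (λ b → suc (bitsSent (next b) x (extend σ u))) gx≡b

    -- Bob's messages

    module _ (S : Matrix m N) (next : Bool → Protocol m N O) (simulable : ∀ b → Simulable (next b)) where

      bob-step : ∀ b σ′ → (∀ u → parity S (extend σ′ u) ≡ b) → Step (bob S next) (next b) σ′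
      bob-step b σ′ parity≡ x lx u =
        cong (λ b → run (next b) x (extend σ′ u)) (parity≡ u) ,
        cong (λ b → suc (bitsSent (next b) x (extend σ′ u))) (parity≡ u)

      -- This covers two cases. If `i` is queried, every live `x` is kept and `avoids` is vacuous;
      -- if `i` is free, `q` retains only the `x` that do not point to `j`.
      solve-form : ∀ σ q i j a A →
        (∀ u → parity S (extend σ u) ≡ ⟦ a , A ⟧ u) → entry A i j ≡ true →
        (∀ x → q x ≡ true → live σ x ≡ true) →
        (∀ x → q x ≡ true → lookup (cube σ) i ≡ nothing → lookup x i ≢ j) →
        size σ ≤ 2 * count (cube σ) q →
        ∀ c → 0 < size σ → Cost≤ (bob S next) σ c → Simulation (bob S next) σ c
      solve-form σ q i j a A parity≡ Aᵢⱼ q⊆ avoids s≤ =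
        advance {σ′ = σ′} (record { live⊆ = q⊆ ; refine = substitute i j φ ; extend≡ = λ _ → refl })
          -- The solved form vanishes on the whole family, so Bob's bit is `false`.
          refl s≤ (bob-step false σ′ λ u → trans (parity≡ _) (solution-vanishes a A i j Aᵢⱼ u))
          (simulable false)
        where
        φ = a , set i j false A
        σ′ = specialise σ (cube σ) q i j φ q⊆ (λ _ → id) avoids

      module Query (σ : State) (q : AliceInput m N → Bool) (i : Fin N) (j : Fin m)
                   (ρᵢ : lookup (cube σ) i ≡ nothing)
                   (q⊆ : ∀ x → q x ≡ true → live σ x ≡ true)
                   (xᵢ≡j : ∀ x → q x ≡ true → lookup x i ≡ j)
                   (s≤ : size σ ≤ 2 * count (cube σ) q) where

        ρ′ : Cube m N
        ρ′ = cube σ [ i ]≔ just j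

        fixed : lookup ρ′ i ≢ nothing
        fixed ρ′ᵢ = contradiction (trans (sym (lookup∘update i (cube σ) (just j))) ρ′ᵢ) λ ()

        unchanged : ∀ k → k ≢ i → lookup ρ′ k ≡ lookup (cube σ) k
        unchanged k k≢i = lookup∘update′ k≢i (cube σ) (just j)

        ρ′⊆ : ∀ k → lookup ρ′ k ≡ nothing → lookup (cube σ) k ≡ nothing
        ρ′⊆ k ρ′ₖ with k Fin.≟ i
        ... | yes refl = ρᵢ
        ... | no  k≢i  = trans (sym (unchanged k k≢i)) ρ′ₖ

        -- Every `x` in `q` reads the entry `(i , j)`. It may still be overwritten, since
        -- transparency concerns free coordinates and `i` is fixed in `ρ′`.
        answered : Bool → State
        answered b = specialise σ ρ′ q i j (constant b) q⊆ ρ′⊆ (λ _ _ ρ′ᵢ → contradiction ρ′ᵢ fixed)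

        answered-⊑ : ∀ b → answered b ⊑ σ
        answered-⊑ b = record
          { live⊆ = q⊆ ; refine = substitute i j (constant b) ; extend≡ = λ _ → refl }

        size-answered : size σ ≤ 2 * count ρ′ q
        size-answered = subst (λ s → size σ ≤ 2 * s) (count-fix (cube σ) q i j ρᵢ xᵢ≡j) s≤

        -- At `i`, the old transparency reduces the bit read to the parameter entry `(i , j)`, where
        -- the answer was just written. At the other queried coordinates the old consistency
        -- applies.
        answered-consistent : ∀ z → Consistent σ z → Consistent (answered (lookup z i)) z
        answered-consistent z consistent x qx u k ρ′ₖ with k Fin.≟ i
        ... | no k≢i   = consistent x (q⊆ x qx) (substitute i j (constant (lookup z i)) u) k
                           (ρ′ₖ ∘ trans (unchanged k k≢i))
        ... | yes refl = begin
          entry (extend σ u′) i (lookup x i)  ≡⟨ transparent σ x (q⊆ x qx) u′ i ρᵢ ⟩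
          entry u′ i (lookup x i)             ≡⟨ cong (entry u′ i) (xᵢ≡j x qx) ⟩
          entry u′ i j                        ≡⟨ entry-set i j _ u ⟩
          ⟦ constant (lookup z i) ⟧ u         ≡⟨ ⟦constant⟧ (lookup z i) u ⟩
          lookup z i                          ∎
          where
          open ≡-Reasoning
          u′ = substitute i j (constant (lookup z i)) u

        query-simulation : ∀ {Π c} → (∀ b → Simulation Π (answered b) c) → Simulation Π σ c
        query-simulation {Π} {c} sim = record
          { tree     = query i (tree ∘ sim)
          ; bounded  = subst (λ k → Bound (suc (h false ⊔ h true)) (size σ) k c)
                         (sym (dim-fix (cube σ) i j ρᵢ))
                         (bound-query (h false ⊔ h true) (dim ρ′) c size-answered bound)
          ; faithful = λ z consistent →
              let x , u , qx , ind≡z , eval≡run =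
                    faithful (sim (lookup z i)) z (answered-consistent z consistent)
              in x , substitute i j (constant (lookup z i)) u , q⊆ x qx , ind≡z , eval≡run
          }
          where
          h : Bool → ℕ
          h b = height (tree (sim b))

          -- Both answers lead to the same cube and live set, so the bound of the higher subtree is
          -- the one required.
          bound : Bound (h false ⊔ h true) (count ρ′ q) (dim ρ′) c
          bound with ⊔-sel (h false) (h true)
          ... | inj₁ e = subst (λ k → Bound k (count ρ′ q) (dim ρ′) c) (sym e) (bounded (sim false))
          ... | inj₂ e = subst (λ k → Bound k (count ρ′ q) (dim ρ′) c) (sym e) (bounded (sim true))

      -- A query does not consume Bob's bit: the protocol and the budget stay the same, and the form
      -- is computed afresh. Each query fixes a free coordinate, so recursion on the dimension
      -- terminates.
      simulable-bob : ∀ k σ c → dim (cube σ) ≡ k → 0 < size σ →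
                      Cost≤ (bob S next) σ c → Simulation (bob S next) σ c
      simulable-bob k σ c dim≡k 0<s cost with affine σ S
      ... | (a , A) , parity≡ with any? (λ i → any? (λ j → entry A i j ≟ true))
      ...   | no A≡0 =
        -- A form without coefficients is already constant, and the state is kept as it is.
        advance {σ′ = σ} (record { live⊆ = λ _ → id ; refine = id ; extend≡ = λ _ → refl })
          refl (m≤m+n _ _) (bob-step a σ const-parity) (simulable a) c 0<s cost
        where
        const-parity : ∀ u → parity S (extend σ u) ≡ a
        const-parity u = trans (parity≡ u) (trans
          (cong (a xor_) (parity-zero A u (λ i j → ¬-not (λ Aᵢⱼ → A≡0 (i , j , Aᵢⱼ)))))
          (xor-identityʳ a))
      ...   | yes (i , j , Aᵢⱼ) with lookup (cube σ) i in ρᵢ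
      ...     | just _  = solve-form σ (live σ) i j a A parity≡ Aᵢⱼ (λ _ → id)
        (λ _ _ ρᵢ≡ → contradiction (trans (sym ρᵢ) ρᵢ≡) λ ()) (m≤m+n _ _) c 0<s cost
      ...     | nothing with halve (cube σ) (live σ) (hits i j)
      ...       | false , s≤ = solve-form σ _ i j a A parity≡ Aᵢⱼ
        (λ x → proj₁ ∘ ∣↦-sound (live σ) (hits i j) false x)
        (λ x qx _ xᵢ≡j → contradiction
          (trans (sym (dec-true (lookup x i Fin.≟ j) xᵢ≡j)) (proj₂ (∣↦-sound (live σ) (hits i j) false x qx))) λ ())
        s≤ c 0<s cost
      -- Coordinate `i` is free, so the dimension cannot be zero.
      simulable-bob zero σ c dim≡k 0<s cost | _ | yes (i , j , _) | nothing | true , s≤ =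
        contradiction (trans (sym dim≡k) (dim-fix (cube σ) i j ρᵢ)) λ ()
      simulable-bob (suc k) σ c dim≡k 0<s cost | _ | yes (i , j , _) | nothing | true , s≤ =
        query-simulation λ b → simulable-bob k (answered b) c
          (suc-injective (trans (sym (dim-fix (cube σ) i j ρᵢ)) dim≡k))
          (positive-half 0<s size-answered)
          (cost-⊑ (bob S next) c (answered-⊑ b) cost)
        where
        xᵢ≡j : ∀ x → (live σ ∣ hits i j ↦ true) x ≡ true → lookup x i ≡ j
        xᵢ≡j x qx = hits-sound i j x (proj₂ (∣↦-sound (live σ) (hits i j) true x qx))
        open Query σ _ i j ρᵢ (λ x → proj₁ ∘ ∣↦-sound (live σ) (hits i j) true x) xᵢ≡j s≤

    simulable : ∀ Π → Simulable Π
    simulable (output w)             = simulable-output w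
    simulable (alice g next)         = simulable-alice g next (simulable ∘ next)
    simulable (bob S next) σ c       = simulable-bob S next (simulable ∘ next) _ σ c refl

-- Decision trees from protocols

-- Square the hypothesis, use `4 ^ h ≤ m ^ h`, and cancel one factor `m ^ h`. The result is `h`
-- times half of log m to base 2 being at most `c`, with the logarithm cleared.
root-bound : ∀ m → 4 ≤ m → ∀ h c → m ^ h ≤ 2 ^ (c + h) → m ^ h ≤ 2 ^ (2 * c)
root-bound m 4≤m h c bound = *-cancelʳ-≤ (m ^ h) (2 ^ (2 * c)) (m ^ h) {{m^n≢0 m h {{m≢0}}}} (begin
  m ^ h * m ^ h                ≤⟨ *-mono-≤ bound bound ⟩
  2 ^ (c + h) * 2 ^ (c + h)    ≡⟨ sym (^-distribˡ-+-* 2 (c + h) (c + h)) ⟩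
  2 ^ ((c + h) + (c + h))      ≡⟨ cong (2 ^_) (solve 2 (λ c h → (c :+ h) :+ (c :+ h) := con 2 :* c :+ con 2 :* h) refl c h) ⟩
  2 ^ (2 * c + 2 * h)          ≡⟨ ^-distribˡ-+-* 2 (2 * c) (2 * h) ⟩
  2 ^ (2 * c) * 2 ^ (2 * h)    ≡⟨ cong (2 ^ (2 * c) *_) (sym (^-*-assoc 2 2 h)) ⟩
  2 ^ (2 * c) * 4 ^ h          ≤⟨ *-monoʳ-≤ (2 ^ (2 * c)) (^-monoˡ-≤ h 4≤m) ⟩
  2 ^ (2 * c) * m ^ h          ∎)
  where
  open ≤-Reasoning
  open +-*-Solver
  m≢0 : NonZero m
  m≢0 = >-nonZero (≤-trans z<s 4≤m)

protocol⇒tree : ∀ {o} {O : Set o} m → 4 ≤ m → (Π : Protocol m N O) → ∀ c →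
  (∀ x y → bitsSent Π x y ≤ c) →
  ∃ λ (T : DecisionTree N O) → m ^ height T ≤ 2 ^ (2 * c) ×
    (∀ z → ∃₂ λ x y → INDᴺ x y ≡ z × evalDT T z ≡ run Π x y)
protocol⇒tree {N} m 4≤m Π c cost =
  tree , root-bound m 4≤m (height tree) c bound , λ z →
    -- Nothing is queried at the start, so every `z` is consistent.
    let x , y , _ , ind≡z , eval≡run = faithful z (λ _ _ _ i ρᵢ → contradiction (lookup-replicate i nothing) ρᵢ)
    in x , y , ind≡z , eval≡run
  where
  ρ : Cube m N
  ρ = replicate N nothing
  start : State
  start = record
    { cube = ρ ; live = const true ; extend = id ; affine = affine-id ; transparent = λ _ _ _ _ _ → refl }
  instance
    m≢0 : NonZero m
    m≢0 = >-nonZero (≤-trans z<s 4≤m)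
  open Simulation (simulable Π start c (subst (0 <_) (sym (count-full ρ)) (m^n>0 m (dim ρ))) (λ x _ → cost x))
  bound : m ^ height tree ≤ 2 ^ (c + height tree)
  -- At the start all points of the subcube are live, so size and capacity cancel.
  bound = *-cancelʳ-≤ _ _ (m ^ dim ρ) {{m^n≢0 m (dim ρ)}} (begin
    m ^ height tree * m ^ dim ρ               ≡⟨ cong (m ^ height tree *_) (sym (count-full ρ)) ⟩
    m ^ height tree * count ρ (const true)    ≤⟨ bounded ⟩
    m ^ dim ρ * 2 ^ (c + height tree)         ≡⟨ *-comm (m ^ dim ρ) _ ⟩
    2 ^ (c + height tree) * m ^ dim ρ         ∎)
    where open ≤-Reasoning

theorem15 : ∀ {a ℓ : Level} (m : ℕ) → 4 ≤ m → (N : ℕ) →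
    ((f : Vec Bool N → Bool) (c d : ℕ) →
    IsC*⊕ {m} (f ∘INDᴺ) c → IsCdt f d → m ^ d ≤ 2 ^ (2 * c))
    ×
    ((W : Set a) (R : REL (Vec Bool N) W ℓ) (c d : ℕ) →
    IsC*⊕Rel {m = m} (R ∘INDᴺ) c → IsCdtRel R d → m ^ d ≤ 2 ^ (2 * c))
theorem15 m 4≤m N = for-functions , for-relations
  where
  m≢0 : NonZero m
  m≢0 = >-nonZero (≤-trans z<s 4≤m)

  for-functions : ∀ f c d → IsC*⊕ {m} {N} (f ∘INDᴺ) c → IsCdt f d → m ^ d ≤ 2 ^ (2 * c)
  for-functions f c d ((Π , correct , cost) , _) (_ , minimal)
    with protocol⇒tree m 4≤m Π c cost
  -- `T` computes `f`, so the optimal depth `d` is at most its height.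
  ... | T , bound , faithful = ≤-trans (^-monoʳ-≤ m {{m≢0}} (minimal _ (T , T-correct , refl))) bound
    where
    T-correct : ∀ z → evalDT T z ≡ f z
    T-correct z with faithful z
    ... | x , y , refl , eval≡run = trans eval≡run (correct x y)

  for-relations : ∀ W (R : REL (Vec Bool N) W _) c d →
                  IsC*⊕Rel {m = m} (R ∘INDᴺ) c → IsCdtRel R d → m ^ d ≤ 2 ^ (2 * c)
  for-relations W R c d ((Π , correct , cost) , _) (_ , minimal)
    with protocol⇒tree m 4≤m Π c cost
  ... | T , bound , faithful = ≤-trans (^-monoʳ-≤ m {{m≢0}} (minimal _ (T , T-correct , refl))) bound
    where
    T-correct : ∀ z → IsAnswer (R z) (evalDT T z)
    T-correct z with faithful z
    -- Whether an output is an answer depends only on the decoded string, so a correct ⊥ carries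
    -- over as well.
    ... | x , y , refl , eval≡run = subst (IsAnswer (R (INDᴺ x y))) (sym eval≡run) (correct x y)
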